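{- Let $n,j,k$ be integers with $n\ge 3$ and $1\le j,k<n/2$ and $\gcd(n,j,k)=1$, and let $I(n,j,k)$ be the corresponding $I$-graph. If $I(n,j,k)$ is $[1,\lambda,8]$-cycle regular for some integer $\lambda$, then $I(n,j,k)$ is isomorphic to $I(n',1,k')$ for some \[(n',k')\in \{ (3,1), (4,1),(5,2),(8,3), (10,2),(10,3), (12,5),(13,5),(24,5), (26,5) \}.\]
   Context: For integers $n\ge 3$ and $1\le j,k<n/2$, the $I$-graph $I(n,j,k)$ has vertex set $\{u_0,\dots,u_{n-1},w_0,\dots,w_{n-1}\}$ and edge set consisting of the outer edges $u_iu_{i+j}$, the inner edges $w_iw_{i+k}$ and the spoke edges $u_iw_i$, for $i=0,\dots,n-1$, with subscripts taken modulo $n$. (The condition $\gcd(n,j,k)=1$ is exactly the condition that $I(n,j,k)$ is connected.) For integers $l,\lambda,m$, a simple graph is $[l,\lambda,m]$-cycle regular if every path on $l+1$ vertices belongs to exactly $\lambda$ different cycles of length $m$; in particular $[1,\lambda,8]$-cycle regular means every edge lies on exactly $\lambda$ distinct $8$-cycles. -}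

module Defs where

open import Data.Bool using (Bool; true; false; _∧_; _∨_; not)
open import Data.Nat using (ℕ; zero; suc; _+_; _≡ᵇ_)
open import Data.Nat.DivMod using (_%_)
open import Data.Fin using (Fin; toℕ)
open import Data.Sum using (_⊎_; inj₁; inj₂)
open import Data.List using (List; []; _∷_; map; _++_; concatMap; allFin; filterᵇ; length)
open import Relation.Binary.PropositionalEquality using (_≡_)
open import Function.Bundles using (_↔_; Inverse)
open import Data.Product using (Σ)

-- reduction modulo n (n = 0 never arises for a vertex index; identity there)
modN : ℕ → ℕ → ℕ
modN zero    x = x
modN (suc m) x = x % suc m

-- The I-graph I(n,j,k)
-- vertices: inj₁ i = u_i (outer), inj₂ i = w_i (inner), i ∈ Z_n

IVertex : ℕ → Set
IVertex n = Fin n ⊎ Fin n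

stepIs : (n s : ℕ) → Fin n → Fin n → Bool
stepIs n s a b = modN n (toℕ a + s) ≡ᵇ toℕ b

finEq : ∀ {n} → Fin n → Fin n → Bool
finEq a b = toℕ a ≡ᵇ toℕ b

Iadj : (n j k : ℕ) → IVertex n → IVertex n → Bool
Iadj n j k (inj₁ a) (inj₁ b) = stepIs n j a b ∨ stepIs n j b a
Iadj n j k (inj₂ a) (inj₂ b) = stepIs n k a b ∨ stepIs n k b a
Iadj n j k (inj₁ a) (inj₂ b) = finEq a b
Iadj n j k (inj₂ a) (inj₁ b) = finEq a b

vEq : ∀ {n} → IVertex n → IVertex n → Bool
vEq (inj₁ a) (inj₁ b) = finEq a b
vEq (inj₂ a) (inj₂ b) = finEq a b
vEq _        _        = false

allVertices : (n : ℕ) → List (IVertex n)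
allVertices n = map inj₁ (allFin n) ++ map inj₂ (allFin n)

lists : ∀ {A : Set} → List A → ℕ → List (List A)
lists xs zero    = [] ∷ []
lists xs (suc m) = concatMap (λ x → map (x ∷_) (lists xs m)) xs

notIn : ∀ {n} → IVertex n → List (IVertex n) → Bool
notIn x []       = true
notIn x (y ∷ ys) = not (vEq x y) ∧ notIn x ys

allDistinct : ∀ {n} → List (IVertex n) → Bool
allDistinct []       = true
allDistinct (x ∷ xs) = notIn x xs ∧ allDistinct xs

isPath : (n j k : ℕ) → List (IVertex n) → Bool
isPath n j k []             = true
isPath n j k (x ∷ [])       = true
isPath n j k (x ∷ y ∷ rest) = Iadj n j k x y ∧ isPath n j k (y ∷ rest)

last : ∀ {A : Set} → A → List A → A
last a []       = a
last a (x ∷ xs) = last x xs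

isEightCycleThrough : (n j k : ℕ) → IVertex n → IVertex n → List (IVertex n) → Bool
isEightCycleThrough n j k u v ws =
  allDistinct (u ∷ v ∷ ws) ∧ isPath n j k (u ∷ v ∷ ws) ∧ Iadj n j k (last v ws) u

-- number of distinct 8-cycles of I(n,j,k) containing the edge uv:
-- each such cycle is traversed in exactly one way starting u, v, … ,
-- so these cycles correspond bijectively to the 6-tuples (x₂,…,x₇) counted here.
eightCyclesThrough : (n j k : ℕ) → IVertex n → IVertex n → ℕ
eightCyclesThrough n j k u v =
  length (filterᵇ (isEightCycleThrough n j k u v) (lists (allVertices n) 6))

OneCycleRegular8 : (n j k λ′ : ℕ) → Set
OneCycleRegular8 n j k λ′ =
  ∀ (u v : IVertex n) → Iadj n j k u v ≡ true → eightCyclesThrough n j k u v ≡ λ′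

IsoI : (n j k n′ j′ k′ : ℕ) → Set
IsoI n j k n′ j′ k′ =
  Σ (IVertex n ↔ IVertex n′) λ f →
    ∀ x y → Iadj n′ j′ k′ (Inverse.to f x) (Inverse.to f y) ≡ Iadj n j k x y

exceptionalPairs : List (ℕ Data.Product.× ℕ)
exceptionalPairs =
  (3 , 1) ∷ (4 , 1) ∷ (5 , 2) ∷ (8 , 3) ∷ (10 , 2) ∷ (10 , 3) ∷
  (12 , 5) ∷ (13 , 5) ∷ (24 , 5) ∷ (26 , 5) ∷ []
  where open Data.Product using (_,_)

{-# OPTIONS --safe #-}

-- Up to rotation there are three edges, u₀u_j, w₀w_k and u₀w₀.  Walking from such an edge reaches
-- vertices u_{aj+bk} or w_{aj+bk}, so the number of 8-cycles through it depends only on which integer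
-- vectors (a,b) with small entries satisfy aj + bk ≡ 0 (mod n).  Two linearly independent solutions
-- force n to divide their determinant, because gcd(n,j,k) = 1.  Hence for n > 40 the relevant
-- solutions lie on one line through the origin, and on each possible line the three counts differ.
-- For n ≤ 40 the counts are evaluated, and a balanced triple (n,j,k) is carried to I(n′,1,k′) by
-- i ↦ ai for a unit a, possibly exchanging the two sides.
module Submission where

open import Defs
open import Data.Nat using (ℕ; _≤_; _<_; _*_)
open import Data.Nat.GCD using (gcd)
open import Data.Product using (Σ; _×_; _,_)
open import Data.List.Membership.Propositional using (_∈_)
open import Relation.Binary.PropositionalEquality using (_≡_)

open import Data.Bool using (Bool; true; false; _∧_; _∨_; not; if_then_else_; T)
open import Data.Bool.ListAction using (all)
import Data.Bool.Properties as Bool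
open import Data.Empty using (⊥)
open import Data.Fin as Fin using (Fin; toℕ; fromℕ<)
import Data.Fin.Properties as Fin
open import Data.Integer as ℤ using (ℤ; +_; -[1+_]; ∣_∣; 0ℤ; 1ℤ)
open import Data.Integer.DivMod using (_%ℕ_; _/ℕ_; n%ℕd<d; a≡a%ℕn+[a/ℕn]*n)
open import Data.Integer.Divisibility.Signed
import Data.Integer.Properties as ℤ
open import Data.Integer.Tactic.RingSolver using (solve-∀)
open import Data.List using (List; []; _∷_; map; concatMap; length; filterᵇ; upTo; _++_; allFin; tabulate)
open import Data.List.Membership.Propositional using (find)
open import Data.List.Membership.Propositional.Properties using (∈-upTo⁺; ∈-map⁺)
open import Data.List.Properties
  using (length-++; length-filter; filter-++; map-++; map-∘; map-cong; map-cong-local; map-tabulate)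
open import Data.List.Relation.Unary.All as All using (All; []; _∷_)
open import Data.List.Relation.Unary.All.Properties using (all⁺; ++⁺; ¬Any⇒All¬)
open import Data.List.Relation.Unary.Any using (Any; any?; here; there; satisfied)
open import Data.Maybe using (Maybe; just; nothing)
open import Data.Nat as ℕ using (zero; suc; _≡ᵇ_; _<ᵇ_; z≤n; s≤s)
import Data.Nat.Divisibility as ℕ
import Data.Nat.DivMod as ℕ
open import Data.Nat.GCD using (gcd-greatest; c*gcd[m,n]≡gcd[cm,cn])
open import Data.Nat.ListAction using (sum)
open import Data.Nat.ListAction.Properties using (sum-++)
import Data.Nat.Properties as ℕ
open import Data.Product using (proj₁; proj₂)
open import Data.Product.Properties using (≡-dec)
open import Data.Sum as Sum using (_⊎_; inj₁; inj₂; [_,_]′)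
open import Data.Sum.Function.Propositional using (_⊎-↔_)
import Data.Sum.Properties as Sum
open import Function using (_∘_; id; _⇔_; mk⇔; Equivalence)
open import Function.Bundles using (_↔_; mk↔ₛ′)
open import Function.Construct.Composition using (_↔-∘_)
open import Relation.Binary.PropositionalEquality
  using (_≢_; refl; sym; trans; cong; cong₂; subst; subst₂; module ≡-Reasoning)
open import Relation.Nullary using (Dec; does; yes; no; ¬_; contradiction)
open import Relation.Nullary.Decidable using (_×-dec_; _⊎-dec_; does-⇔; dec-true; dec-false; T?)
open ≡-Reasoning

-- Integer vectors and Boolean formulas over congruences.

Vec² : Set
Vec² = ℤ × ℤ

infixl 6 _⊕_ _⊖_
infix 8 ⊝_
infix 4 _≟²_
infixr 5 _and_ _or_ _and′_

_⊕_ _⊖_ : Vec² → Vec² → Vec²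
(a , b) ⊕ (p , q) = a ℤ.+ p , b ℤ.+ q
(a , b) ⊖ (p , q) = a ℤ.- p , b ℤ.- q

⊝_ : Vec² → Vec²
⊝ (a , b) = ℤ.- a , ℤ.- b

scale : ℤ → Vec² → Vec²
scale t (a , b) = t ℤ.* a , t ℤ.* b

det : Vec² → Vec² → ℤ
det (a , b) (p , q) = a ℤ.* q ℤ.- b ℤ.* p

𝟎 e₁ e₂ : Vec²
𝟎  = 0ℤ , 0ℤ
e₁ = 1ℤ , 0ℤ
e₂ = 0ℤ , 1ℤ

_≟²_ : (v w : Vec²) → Dec (v ≡ w)
_≟²_ = ≡-dec ℤ._≟_ ℤ._≟_

-- atom v stands for the congruence v₁ j + v₂ k ≡ 0 (mod n).
data Formula : Set where
  atom  : Vec² → Formula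
  const : Bool → Formula
  _and_ : Formula → Formula → Formula
  neg   : Formula → Formula

_or_ : Formula → Formula → Formula
φ or ψ = neg (neg φ and neg ψ)

eval : (Vec² → Bool) → Formula → Bool
eval o (atom v)  = o v
eval o (const b) = b
eval o (φ and ψ) = eval o φ ∧ eval o ψ
eval o (neg φ)   = not (eval o φ)

guard : Bool → Formula → Formula
guard b φ = if b then φ else const false

_and′_ : Formula → Formula → Formula
const b and′ ψ       = guard b ψ
φ       and′ const b = guard b φ
φ       and′ ψ       = φ and ψ

neg′ : Formula → Formula
neg′ (const b) = const (not b)
neg′ φ         = neg φ

Knowledge : Set
Knowledge = Vec² → Maybe Bool

simplify : Knowledge → Formula → Formula
simplify K (const b) = const b
simplify K (φ and ψ) = simplify K φ and′ simplify K ψ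
simplify K (neg φ)   = neg′ (simplify K φ)
simplify K (atom v)  with K v
... | just b  = const b
... | nothing = atom v

-- Symbolic walks and the octagon conditions.

-- The vertices u_{aj+bk} and w_{aj+bk} reached from u₀ or w₀, before reduction modulo n.
SVertex : Set
SVertex = Vec² ⊎ Vec²

neighbours : SVertex → List SVertex
neighbours (inj₁ v) = inj₁ (v ⊕ e₁) ∷ inj₁ (v ⊖ e₁) ∷ inj₂ v ∷ []
neighbours (inj₂ v) = inj₂ (v ⊕ e₂) ∷ inj₂ (v ⊖ e₂) ∷ inj₁ v ∷ []

-- Backtracking walks are kept: they repeat a vertex at displacement `𝟎`, so `distinct` makes them
-- false.
walks : SVertex → ℕ → List (List SVertex)
walks x zero    = [] ∷ []
walks x (suc m) = concatMap (λ y → map (y ∷_) (walks y m)) (neighbours x)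

same : SVertex → SVertex → Formula
same (inj₁ v) (inj₁ w) = atom (v ⊖ w)
same (inj₂ v) (inj₂ w) = atom (v ⊖ w)
same _        _        = const false

adjacent : SVertex → SVertex → Formula
adjacent (inj₁ v) (inj₁ w) = atom (v ⊕ e₁ ⊖ w) or atom (w ⊕ e₁ ⊖ v)
adjacent (inj₂ v) (inj₂ w) = atom (v ⊕ e₂ ⊖ w) or atom (w ⊕ e₂ ⊖ v)
adjacent (inj₁ v) (inj₂ w) = atom (v ⊖ w)
adjacent (inj₂ v) (inj₁ w) = atom (v ⊖ w)

avoids : SVertex → List SVertex → Formula
avoids x []       = const true
avoids x (y ∷ ys) = neg (same x y) and avoids x ys

distinct : List SVertex → Formula
distinct []       = const true
distinct (x ∷ xs) = avoids x xs and distinct xs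

-- Consecutive vertices of a walk are adjacent by construction, so only the last edge is tested. It
-- comes first because `_and′_` ignores its right operand after `const false`: walks that cannot
-- close are discarded before the 28 pairs of vertices are compared.
closes : SVertex → SVertex → List SVertex → Formula
closes x y zs = adjacent (last y zs) x and distinct (x ∷ y ∷ zs)

octagons : SVertex → SVertex → List Formula
octagons x y = map (closes x y) (walks y 6)

Triple : Set
Triple = List Formula × List Formula × List Formula

octagons₃ : Triple
octagons₃ = octagons (inj₁ 𝟎) (inj₁ e₁) , octagons (inj₂ 𝟎) (inj₂ e₂) , octagons (inj₁ 𝟎) (inj₂ 𝟎)

-- This test and `valid` are purely syntactic; a formula that simplification leaves undecided passes
-- the first and fails the second.
satisfiable : Formula → Bool
satisfiable (const false) = false
satisfiable _             = true

valid : Formula → Bool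
valid (const true) = true
valid _            = false

reduce : Knowledge → List Formula → List Formula
reduce K φs = filterᵇ satisfiable (map (simplify K) φs)

reduce₃ : Knowledge → Triple → Triple
reduce₃ K (φs , ψs , χs) = reduce K φs , reduce K ψs , reduce K χs

-- Consequences of a single congruence, and the case distinction for large `n`.

-- Atoms come from at most eight steps, so their entries have absolute sum at most 8, while each
-- nonzero `c` in use has absolute sum at least 2. Hence multiples beyond 4 do not occur.
multipliers : List ℤ
multipliers = -[1+ 3 ] ∷ -[1+ 2 ] ∷ -[1+ 1 ] ∷ -[1+ 0 ] ∷ + 0 ∷ + 1 ∷ + 2 ∷ + 3 ∷ + 4 ∷ []

member? : (B : List Vec²) (v : Vec²) → Dec (Any (λ b → v ≡ b ⊎ v ≡ ⊝ b) B)
member? B v = any? (λ b → (v ≟² b) ⊎-dec (v ≟² ⊝ b)) B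

multiple? : (c v : Vec²) → Dec (Any (λ t → v ≡ scale t c) multipliers)
multiple? c v = any? (λ t → v ≟² scale t c) multipliers

-- What is forced at v when c is a solution modulo some n ≥ N with gcd(n,j,k) = 1 and no member of B is
-- one; a nonzero determinant below N excludes v by Cramer's rule.
knowledge : ℕ → List Vec² → Vec² → Knowledge
knowledge N B c v =
  if does (member? B v) then just false else
  if does (∣ det c v ∣ ℕ.≟ 0)
    then (if does (multiple? c v) then just true else
          if does (member? B (v ⊖ c)) then just false else
          if does (member? B (v ⊕ c)) then just false else nothing)
    else (if does (∣ det c v ∣ ℕ.<? N) then just false else nothing)

-- At these vectors the linear form takes the values j, 2j, k, 2k and j + k, all strictly between 0
-- and n.
nonzero : List Vec²
nonzero = (+ 1 , + 0) ∷ (+ 2 , + 0) ∷ (+ 0 , + 1) ∷ (+ 0 , + 2) ∷ (+ 1 , + 1) ∷ []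

-- As 1 ≤ j,k < n/2, this is a solution only for j = k.
diag : Vec²
diag = + 1 , -[1+ 0 ]

-- The displacements at which a walk of length 8 may close up.  The vectors (4,0), (6,0), (1,±3) and
-- their transposes arise only when the last step enters the first vertex through the second,
-- which simplification does not recognise as a repetition.
closing : List Vec²
closing = (+ 8 , + 0) ∷ (+ 0 , + 8) ∷ (+ 2 , + 2) ∷ (+ 2 , -[1+ 1 ])
  ∷ (+ 1 , + 5) ∷ (+ 1 , -[1+ 4 ]) ∷ (+ 2 , + 4) ∷ (+ 2 , -[1+ 3 ]) ∷ (+ 3 , + 3) ∷ (+ 3 , -[1+ 2 ])
  ∷ (+ 4 , + 0) ∷ (+ 0 , + 4) ∷ (+ 6 , + 0) ∷ (+ 0 , + 6)
  ∷ (+ 1 , + 3) ∷ (+ 1 , -[1+ 2 ]) ∷ (+ 3 , + 1) ∷ (+ 3 , -[1+ 0 ])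
  ∷ (+ 4 , + 2) ∷ (+ 4 , -[1+ 1 ]) ∷ (+ 5 , + 1) ∷ (+ 5 , -[1+ 0 ]) ∷ []

count : ∀ {A : Set} → (A → Bool) → List A → ℕ
count p xs = length (filterᵇ p xs)

-- For reduced lists, the length bounds the number of true formulas from above and the number of
-- valid ones bounds it from below.
separated : List Formula → List Formula → Bool
separated φs ψs = length φs <ᵇ count valid ψs

unbalanced : Triple → Bool
unbalanced (φs , ψs , χs) =
  separated φs χs ∨ separated ψs χs ∨ separated χs φs ∨ separated χs ψs

-- The knowledge common to all admissible triples: only `𝟎` is taken as a solution, and the bound 0
-- holds for every `n`. Reducing by it once shortens the lists on which both checks run.
base : Knowledge
base = knowledge 0 nonzero 𝟎

-- diag is a solution; or neither diag nor any closing vector is; or diag is not and a given closing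
-- vector is.
cases : List (List Vec² × Vec²)
cases = (nonzero , diag) ∷ (diag ∷ closing ++ nonzero , 𝟎) ∷ map (diag ∷ nonzero ,_) closing

-- The determinants that the case distinction needs are at most 40.
largeCheck : Triple → Bool
largeCheck F = all (λ Bc → unbalanced (reduce₃ (knowledge 41 (proj₁ Bc) (proj₂ Bc)) F)) cases

-- The finite search for `n` up to 40.

oracle : ℕ → ℕ → ℕ → Vec² → Bool
oracle n j k (a , b) = does (+ n ∣? a ℤ.* + j ℤ.+ b ℤ.* + k)

balanced : Triple → (Vec² → Bool) → Bool
balanced (φs , ψs , χs) o = (count (eval o) φs ≡ᵇ count (eval o) χs) ∧ (count (eval o) ψs ≡ᵇ count (eval o) χs)

PlusMinus : ℕ → ℕ → ℕ → ℕ → Set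
PlusMinus n a j s = (+ n ∣ + a ℤ.* + j ℤ.- + s) ⊎ (+ n ∣ + a ℤ.* + j ℤ.+ + s)

Unit : ℕ → ℕ → Set
Unit n a = Any (λ b → + n ∣ + a ℤ.* + b ℤ.- 1ℤ) (upTo n)

-- The usual sufficient condition for isomorphism of I-graphs: a unit `a` modulo `n` carries j and
-- k, in some order, to ±1 and ±k′. Quantifiers range over `upTo n`, which makes the condition
-- decidable.
Similar : ℕ → ℕ → ℕ → ℕ × ℕ → Set
Similar n j k (n′ , k′) =
  n′ ≡ n ×
  Any (λ a → ((PlusMinus n a j 1 × PlusMinus n a k k′) ⊎ (PlusMinus n a j k′ × PlusMinus n a k 1)) × Unit n a) (upTo n)

plusMinus? : ∀ n a j s → Dec (PlusMinus n a j s)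
plusMinus? n a j s = (+ n ∣? _) ⊎-dec (+ n ∣? _)

similar? : ∀ n j k p → Dec (Similar n j k p)
similar? n j k (n′ , k′) =
  (n′ ℕ.≟ n) ×-dec
  any? (λ a → (((plusMinus? n a j 1) ×-dec (plusMinus? n a k k′)) ⊎-dec
    ((plusMinus? n a j k′) ×-dec (plusMinus? n a k 1))) ×-dec any? (λ b → + n ∣? _) (upTo n)) (upTo n)

exceptional? : ∀ n j k → Dec (Any (Similar n j k) exceptionalPairs)
exceptional? n j k = any? (similar? n j k) exceptionalPairs

admissible : ℕ → ℕ → ℕ → Bool
admissible n j k = (0 <ᵇ j) ∧ (2 ℕ.* j <ᵇ n) ∧ (0 <ᵇ k) ∧ (2 ℕ.* k <ᵇ n) ∧ (gcd (gcd n j) k ≡ᵇ 1)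

-- An implication written with Booleans; the cheap premises stand first, so the search for a unit
-- runs only on admissible balanced triples.
settled : Triple → ℕ → ℕ → ℕ → Bool
settled F n j k = not (admissible n j k) ∨ not (balanced F (oracle n j k)) ∨ does (exceptional? n j k)

-- 2j < n ≤ 40 gives j < 21, and likewise for k.
smallCheck : Triple → Bool
smallCheck F = all (λ n → all (λ j → all (settled F n j) (upTo 21)) (upTo 21)) (upTo 41)

-- Counting in lists, and sums supported on one or two indices.

count-++ : ∀ {A : Set} (p : A → Bool) xs ys → count p (xs ++ ys) ≡ count p xs ℕ.+ count p ys
count-++ p xs ys = trans (cong length (filter-++ (T? ∘ p) xs ys)) (length-++ (filterᵇ p xs))

count-∷ : ∀ {A : Set} (p : A → Bool) x xs → count p (x ∷ xs) ≡ (if p x then 1 else 0) ℕ.+ count p xs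
count-∷ p x xs with p x
... | true  = refl
... | false = refl

count-∷-cong : ∀ {A : Set} (p : A → Bool) x {xs ys} → count p xs ≡ count p ys → count p (x ∷ xs) ≡ count p (x ∷ ys)
count-∷-cong p x {xs} {ys} eq = begin
  count p (x ∷ xs)                       ≡⟨ count-∷ p x xs ⟩
  (if p x then 1 else 0) ℕ.+ count p xs  ≡⟨ cong (_ ℕ.+_) eq ⟩
  (if p x then 1 else 0) ℕ.+ count p ys  ≡⟨ count-∷ p x ys ⟨
  count p (x ∷ ys)                       ∎

count-cong : ∀ {A : Set} {p q : A → Bool} → (∀ x → p x ≡ q x) → ∀ xs → count p xs ≡ count q xs
count-cong {p = p} {q} p≗q []       = refl
count-cong {p = p} {q} p≗q (x ∷ xs) = begin
  count p (x ∷ xs)                        ≡⟨ count-∷ p x xs ⟩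
  (if p x then 1 else 0) ℕ.+ count p xs   ≡⟨ cong₂ (λ b c → (if b then 1 else 0) ℕ.+ c) (p≗q x) (count-cong p≗q xs) ⟩
  (if q x then 1 else 0) ℕ.+ count q xs   ≡⟨ count-∷ q x xs ⟨
  count q (x ∷ xs)                        ∎

count-map : ∀ {A B : Set} (p : B → Bool) (f : A → B) xs → count p (map f xs) ≡ count (p ∘ f) xs
count-map p f []       = refl
count-map p f (x ∷ xs) = begin
  count p (f x ∷ map f xs)                           ≡⟨ count-∷ p (f x) (map f xs) ⟩
  (if p (f x) then 1 else 0) ℕ.+ count p (map f xs)  ≡⟨ cong (_ ℕ.+_) (count-map p f xs) ⟩
  (if p (f x) then 1 else 0) ℕ.+ count (p ∘ f) xs    ≡⟨ count-∷ (p ∘ f) x xs ⟨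
  count (p ∘ f) (x ∷ xs)                             ∎

count-concatMap : ∀ {A B : Set} (p : B → Bool) (f : A → List B) xs →
  count p (concatMap f xs) ≡ sum (map (count p ∘ f) xs)
count-concatMap p f []       = refl
count-concatMap p f (x ∷ xs) =
  trans (count-++ p (f x) (concatMap f xs)) (cong (count p (f x) ℕ.+_) (count-concatMap p f xs))

count-none : ∀ {A : Set} (p : A → Bool) → (∀ x → p x ≡ false) → ∀ xs → count p xs ≡ 0
count-none p none xs = trans (count-cong none xs) (none′ xs)
  where
  none′ : ∀ xs → count (λ _ → false) xs ≡ 0
  none′ []       = refl
  none′ (_ ∷ xs) = none′ xs

count-extensions : ∀ {A : Set} (p : List A → Bool) (f : A → List (List A)) xs →
  count p (concatMap (λ x → map (x ∷_) (f x)) xs) ≡ sum (map (λ x → count (p ∘ (x ∷_)) (f x)) xs)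
count-extensions p f xs =
  trans (count-concatMap p _ xs) (cong sum (map-cong (λ x → count-map p (x ∷_) (f x)) xs))

sum-zero : ∀ {n} (f : Fin n → ℕ) → (∀ i → f i ≡ 0) → sum (tabulate f) ≡ 0
sum-zero {zero}  f f≡0 = refl
sum-zero {suc n} f f≡0 = cong₂ ℕ._+_ (f≡0 Fin.zero) (sum-zero (f ∘ Fin.suc) (f≡0 ∘ Fin.suc))

sum-one : ∀ {n} (f : Fin n → ℕ) a → (∀ i → i ≢ a → f i ≡ 0) → sum (tabulate f) ≡ f a
sum-one f Fin.zero f≡0 =
  trans (cong (f Fin.zero ℕ.+_) (sum-zero (f ∘ Fin.suc) (λ i → f≡0 (Fin.suc i) λ ()))) (ℕ.+-identityʳ _)
sum-one f (Fin.suc a) f≡0 =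
  cong₂ ℕ._+_ (f≡0 Fin.zero λ ()) (sum-one (f ∘ Fin.suc) a λ i i≢a → f≡0 (Fin.suc i) (i≢a ∘ Fin.suc-injective))

sum-two : ∀ {n} (f : Fin n → ℕ) a b → a ≢ b → (∀ i → i ≢ a → i ≢ b → f i ≡ 0) →
  sum (tabulate f) ≡ f a ℕ.+ f b
sum-two f Fin.zero Fin.zero a≢b f≡0 = contradiction refl a≢b
sum-two f Fin.zero (Fin.suc b) a≢b f≡0 =
  cong (f Fin.zero ℕ.+_) (sum-one (f ∘ Fin.suc) b λ i i≢b → f≡0 (Fin.suc i) (λ ()) (i≢b ∘ Fin.suc-injective))
sum-two f (Fin.suc a) Fin.zero a≢b f≡0 =
  trans (cong (f Fin.zero ℕ.+_) (sum-one (f ∘ Fin.suc) a λ i i≢a → f≡0 (Fin.suc i) (i≢a ∘ Fin.suc-injective) λ ()))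
        (ℕ.+-comm (f Fin.zero) _)
sum-two f (Fin.suc a) (Fin.suc b) a≢b f≡0 =
  cong₂ ℕ._+_ (f≡0 Fin.zero (λ ()) λ ())
    (sum-two (f ∘ Fin.suc) a b (a≢b ∘ cong Fin.suc)
      λ i i≢a i≢b → f≡0 (Fin.suc i) (i≢a ∘ Fin.suc-injective) (i≢b ∘ Fin.suc-injective))

sum-allVertices : ∀ {n} (f : IVertex n → ℕ) →
  sum (map f (allVertices n)) ≡ sum (tabulate (f ∘ inj₁)) ℕ.+ sum (tabulate (f ∘ inj₂))
sum-allVertices {n} f = begin
  sum (map f (map inj₁ (allFin n) ++ map inj₂ (allFin n)))
    ≡⟨ cong sum (map-++ f (map inj₁ (allFin n)) _) ⟩
  sum (map f (map inj₁ (allFin n)) ++ map f (map inj₂ (allFin n)))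
    ≡⟨ sum-++ (map f (map inj₁ (allFin n))) _ ⟩
  sum (map f (map inj₁ (allFin n))) ℕ.+ sum (map f (map inj₂ (allFin n)))
    ≡⟨ cong₂ (λ xs ys → sum xs ℕ.+ sum ys) (side inj₁) (side inj₂) ⟩
  sum (tabulate (f ∘ inj₁)) ℕ.+ sum (tabulate (f ∘ inj₂)) ∎
  where
  side : (s : Fin n → IVertex n) → map f (map s (allFin n)) ≡ tabulate (f ∘ s)
  side s = trans (sym (map-∘ (allFin n))) (map-tabulate id (f ∘ s))

-- Residues modulo `n` and divisibility.

linear : ℕ → ℕ → Vec² → ℤ
linear j k (a , b) = a ℤ.* + j ℤ.+ b ℤ.* + k

does-true : ∀ {A : Set} (a? : Dec A) → does a? ≡ true → A
does-true (yes a) _ = a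

does-false : ∀ {A : Set} (a? : Dec A) → does a? ≡ false → ¬ A
does-false (no ¬a) _ = ¬a

∣-small : ∀ {n} z → + n ∣ z → ∣ z ∣ < n → z ≡ 0ℤ
∣-small (+ zero)    _   _   = refl
∣-small (+ suc x)   n∣z z<n = contradiction (∣⇒∣ᵤ n∣z) (ℕ.>⇒∤ z<n)
∣-small (-[1+ x ])  n∣z z<n = contradiction (∣⇒∣ᵤ n∣z) (ℕ.>⇒∤ z<n)

-- Kept as a relation so that vertex positions, products by a unit and the sums inside `modN` are
-- all compared by the one lemma `residue-≡ᵇ`.
record Residue (n : ℕ) (x : ℕ) (z : ℤ) : Set where
  constructor residue
  field
    small     : x < n
    congruent : + n ∣ + x ℤ.- z

-- Two residues differ by less than n in absolute value, so they agree as soon as n divides their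
-- difference. This turns each numerical test in the graph's definition into a divisibility.
residue-≡ᵇ : ∀ {n x y z w} → Residue n x z → Residue n y w → (x ≡ᵇ y) ≡ does (+ n ∣? z ℤ.- w)
residue-≡ᵇ {n} {x} {y} {z} {w} (residue x<n x≈z) (residue y<n y≈w) =
  does-⇔ (mk⇔ to from) (x ℕ.≟ y) (+ n ∣? z ℤ.- w)
  where
  split : ∀ x y z w → x ℤ.- y ℤ.+ (y ℤ.- w) ℤ.- (x ℤ.- z) ≡ z ℤ.- w
  split = solve-∀
  merge : ∀ x y z w → (x ℤ.- z) ℤ.+ (z ℤ.- w) ℤ.- (y ℤ.- w) ≡ x ℤ.- y
  merge = solve-∀
  to : x ≡ y → + n ∣ z ℤ.- w
  to refl = subst (+ n ∣_) (split (+ x) (+ x) z w)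
    (∣m∣n⇒∣m-n (∣m∣n⇒∣m+n (subst (+ n ∣_) (sym (ℤ.+-inverseʳ (+ x))) (divides 0ℤ refl)) y≈w) x≈z)
  bound : ∣ + x ℤ.- + y ∣ < n
  bound = subst (λ z → ∣ z ∣ < n) (sym (ℤ.[+m]-[+n]≡m⊖n x y))
    (ℕ.≤-<-trans (ℤ.∣m⊝n∣≤m⊔n x y) (ℕ.⊔-lub x<n y<n))
  from : + n ∣ z ℤ.- w → x ≡ y
  from z≈w = ℤ.+-injective (ℤ.i-j≡0⇒i≡j (+ x) (+ y)
    (∣-small _ (subst (+ n ∣_) (merge (+ x) (+ y) z w) (∣m∣n⇒∣m-n (∣m∣n⇒∣m+n x≈z z≈w) y≈w)) bound))

pos : ∀ n .{{_ : ℕ.NonZero n}} → ℤ → Fin n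
pos n z = fromℕ< (n%ℕd<d z n)

%-residue : ∀ {n} z .{{_ : ℕ.NonZero n}} → Residue n (z %ℕ n) z
%-residue {n} z = residue (n%ℕd<d z n) (divides (ℤ.- (z /ℕ n)) (begin
  + (z %ℕ n) ℤ.- z                                     ≡⟨ cong (ℤ._-_ (+ (z %ℕ n))) (a≡a%ℕn+[a/ℕn]*n z n) ⟩
  + (z %ℕ n) ℤ.- (+ (z %ℕ n) ℤ.+ (z /ℕ n) ℤ.* + n)     ≡⟨ cancel (+ (z %ℕ n)) (z /ℕ n) (+ n) ⟩
  ℤ.- (z /ℕ n) ℤ.* + n                                 ∎))
  where
  cancel : ∀ r q n → r ℤ.- (r ℤ.+ q ℤ.* n) ≡ ℤ.- q ℤ.* n
  cancel = solve-∀

pos-residue : ∀ {n} z .{{_ : ℕ.NonZero n}} → Residue n (toℕ (pos n z)) z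
pos-residue {n} z = subst (λ x → Residue n x z) (sym (Fin.toℕ-fromℕ< (n%ℕd<d z n))) (%-residue z)

finEq-residue : ∀ {n} z w .{{_ : ℕ.NonZero n}} → finEq (pos n z) (pos n w) ≡ does (+ n ∣? z ℤ.- w)
finEq-residue z w = residue-≡ᵇ (pos-residue z) (pos-residue w)

toℕ-residue : ∀ {n} (i : Fin n) → Residue n (toℕ i) (+ toℕ i)
toℕ-residue i = residue (Fin.toℕ<n i) (subst (_ ∣_) (sym (ℤ.+-inverseʳ (+ toℕ i))) (divides 0ℤ refl))

step-residue : ∀ {n x z} s .{{_ : ℕ.NonZero n}} → Residue n x z → Residue n (modN n (x ℕ.+ s)) (z ℤ.+ + s)
step-residue {suc m} {x} {z} s (residue _ x≈z) with %-residue {suc m} (+ (x ℕ.+ s))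
... | residue r<n r≈x+s = residue r<n (subst (_ ∣_) (shift (+ ((x ℕ.+ s) ℕ.% suc m)) (+ x) z (+ s))
        (∣m∣n⇒∣m+n r≈x+s x≈z))
  where
  shift : ∀ r x z s → (r ℤ.- (x ℤ.+ s)) ℤ.+ (x ℤ.- z) ≡ r ℤ.- (z ℤ.+ s)
  shift = solve-∀

finEq-false : ∀ {n} {a b : Fin n} → a ≢ b → finEq a b ≡ false
finEq-false {a = a} {b} a≢b = dec-false (toℕ a ℕ.≟ toℕ b) (a≢b ∘ Fin.toℕ-injective)

finEq-true : ∀ {n} {a b : Fin n} → finEq a b ≡ true → a ≡ b
finEq-true {a = a} {b} eq = Fin.toℕ-injective (does-true (toℕ a ℕ.≟ toℕ b) eq)

finEq-refl : ∀ {n} (a : Fin n) → finEq a a ≡ true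
finEq-refl a = dec-true (toℕ a ℕ.≟ toℕ a) refl

∣?-swap : ∀ n z w → does (+ n ∣? z ℤ.- w) ≡ does (+ n ∣? w ℤ.- z)
∣?-swap n z w = does-⇔ (mk⇔ (swap z w) (swap w z)) (+ n ∣? z ℤ.- w) (+ n ∣? w ℤ.- z)
  where
  swap : ∀ z w → + n ∣ z ℤ.- w → + n ∣ w ℤ.- z
  swap z w d = subst (+ n ∣_) (solve-swap z w) (∣m⇒∣-m d)
    where
    solve-swap : ∀ z w → ℤ.- (z ℤ.- w) ≡ w ℤ.- z
    solve-swap = solve-∀

∨-via-∧ : ∀ a b → not (not a ∧ not b) ≡ a ∨ b
∨-via-∧ true  b     = refl
∨-via-∧ false true  = refl
∨-via-∧ false false = refl

-- Symbolic vertices placed in the I-graph, and the count of octagons.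

module Interpretation (m j k : ℕ) where
  private n = suc m

  o : Vec² → Bool
  o = oracle n j k

  ⟦_⟧ : SVertex → IVertex n
  ⟦ inj₁ v ⟧ = inj₁ (pos n (linear j k v))
  ⟦ inj₂ v ⟧ = inj₂ (pos n (linear j k v))

  linear-⊖ : ∀ v w → linear j k (v ⊖ w) ≡ linear j k v ℤ.- linear j k w
  linear-⊖ (a , b) (c , d) = solve-⊖ a b c d (+ j) (+ k)
    where
    solve-⊖ : ∀ a b c d j k → (a ℤ.- c) ℤ.* j ℤ.+ (b ℤ.- d) ℤ.* k ≡ a ℤ.* j ℤ.+ b ℤ.* k ℤ.- (c ℤ.* j ℤ.+ d ℤ.* k)
    solve-⊖ = solve-∀

  linear-⊕ : ∀ v w → linear j k (v ⊕ w) ≡ linear j k v ℤ.+ linear j k w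
  linear-⊕ (a , b) (c , d) = solve-⊕ a b c d (+ j) (+ k)
    where
    solve-⊕ : ∀ a b c d j k → (a ℤ.+ c) ℤ.* j ℤ.+ (b ℤ.+ d) ℤ.* k ≡ a ℤ.* j ℤ.+ b ℤ.* k ℤ.+ (c ℤ.* j ℤ.+ d ℤ.* k)
    solve-⊕ = solve-∀

  linear-e₁ : linear j k e₁ ≡ + j
  linear-e₁ = trans (ℤ.+-identityʳ _) (ℤ.*-identityˡ (+ j))

  linear-e₂ : linear j k e₂ ≡ + k
  linear-e₂ = trans (ℤ.+-identityˡ _) (ℤ.*-identityˡ (+ k))

  finEq-pos : ∀ v w → finEq (pos n (linear j k v)) (pos n (linear j k w)) ≡ o (v ⊖ w)
  finEq-pos v w = trans (finEq-residue (linear j k v) (linear j k w))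
    (cong (λ z → does (+ n ∣? z)) (sym (linear-⊖ v w)))

  -- Used twice: with `j` and `e₁` for the outer edges, with `k` and `e₂` for the inner ones.
  module Step (s : ℕ) (e : Vec²) (e-step : linear j k e ≡ + s) where

    forward : ∀ v b → stepIs n s (pos n (linear j k v)) b ≡ finEq (pos n (linear j k (v ⊕ e))) b
    forward v b = begin
      stepIs n s (pos n (linear j k v)) b
        ≡⟨ residue-≡ᵇ (step-residue s (pos-residue (linear j k v))) (toℕ-residue b) ⟩
      does (+ n ∣? linear j k v ℤ.+ + s ℤ.- + toℕ b)
        ≡⟨ cong (λ z → does (+ n ∣? z ℤ.- + toℕ b)) (trans (cong (ℤ._+_ (linear j k v)) (sym e-step)) (sym (linear-⊕ v e))) ⟩
      does (+ n ∣? linear j k (v ⊕ e) ℤ.- + toℕ b)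
        ≡⟨ residue-≡ᵇ (pos-residue (linear j k (v ⊕ e))) (toℕ-residue b) ⟨
      finEq (pos n (linear j k (v ⊕ e))) b ∎

    backward : ∀ v b → stepIs n s b (pos n (linear j k v)) ≡ finEq (pos n (linear j k (v ⊖ e))) b
    backward v b = begin
      stepIs n s b (pos n (linear j k v))
        ≡⟨ residue-≡ᵇ (step-residue s (toℕ-residue b)) (pos-residue (linear j k v)) ⟩
      does (+ n ∣? + toℕ b ℤ.+ + s ℤ.- linear j k v)
        ≡⟨ cong (λ z → does (+ n ∣? z)) (rearrange (+ toℕ b) (+ s) (linear j k v)) ⟩
      does (+ n ∣? + toℕ b ℤ.- (linear j k v ℤ.- + s))
        ≡⟨ ∣?-swap n (+ toℕ b) (linear j k v ℤ.- + s) ⟩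
      does (+ n ∣? linear j k v ℤ.- + s ℤ.- + toℕ b)
        ≡⟨ cong (λ z → does (+ n ∣? z ℤ.- + toℕ b)) (trans (cong (λ t → linear j k v ℤ.- t) (sym e-step)) (sym (linear-⊖ v e))) ⟩
      does (+ n ∣? linear j k (v ⊖ e) ℤ.- + toℕ b)
        ≡⟨ residue-≡ᵇ (pos-residue (linear j k (v ⊖ e))) (toℕ-residue b) ⟨
      finEq (pos n (linear j k (v ⊖ e))) b ∎
      where
      rearrange : ∀ b s z → b ℤ.+ s ℤ.- z ≡ b ℤ.- (z ℤ.- s)
      rearrange = solve-∀

    adjacent-pos : ∀ v w → let a = pos n (linear j k v) ; b = pos n (linear j k w) in
      (o (v ⊕ e ⊖ w) ∨ o (w ⊕ e ⊖ v)) ≡ (stepIs n s a b ∨ stepIs n s b a)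
    adjacent-pos v w = cong₂ _∨_
      (sym (trans (forward v (pos n (linear j k w))) (finEq-pos (v ⊕ e) w)))
      (sym (trans (forward w (pos n (linear j k v))) (finEq-pos (w ⊕ e) v)))

    off-neighbours : ∀ v b → b ≢ pos n (linear j k (v ⊕ e)) → b ≢ pos n (linear j k (v ⊖ e)) →
      let a = pos n (linear j k v) in (stepIs n s a b ∨ stepIs n s b a) ≡ false
    off-neighbours v b ≢⊕ ≢⊖ = cong₂ _∨_
      (trans (forward v b) (finEq-false (≢⊕ ∘ sym)))
      (trans (backward v b) (finEq-false (≢⊖ ∘ sym)))

    adjacent-⊕ : ∀ v → let a = pos n (linear j k v) ; b = pos n (linear j k (v ⊕ e)) in
      (stepIs n s a b ∨ stepIs n s b a) ≡ true
    adjacent-⊕ v = cong (_∨ stepIs n s b a) (trans (forward v b) (finEq-refl b))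
      where
      a = pos n (linear j k v)
      b = pos n (linear j k (v ⊕ e))

    adjacent-⊖ : ∀ v → let a = pos n (linear j k v) ; b = pos n (linear j k (v ⊖ e)) in
      (stepIs n s a b ∨ stepIs n s b a) ≡ true
    adjacent-⊖ v = trans (cong (stepIs n s a b ∨_) (trans (backward v b) (finEq-refl b))) (Bool.∨-zeroʳ _)
      where
      a = pos n (linear j k v)
      b = pos n (linear j k (v ⊖ e))

    -- The two positions differ by 2s, which lies strictly between 0 and n. Thus every vertex has
    -- exactly three neighbours.
    ⊕≢⊖ : 0 < s → 2 ℕ.* s < n → ∀ v → pos n (linear j k (v ⊕ e)) ≢ pos n (linear j k (v ⊖ e))
    ⊕≢⊖ 0<s 2s<n v eq = ℕ.<⇒≢ 0<s (sym (double-zero (ℤ.+-injective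
        (∣-small (+ (2 ℕ.* s)) n∣2s 2s<n))))
      where
      double-zero : 2 ℕ.* s ≡ 0 → s ≡ 0
      double-zero 2s≡0 = ℕ.m+n≡0⇒m≡0 s 2s≡0
      difference : ∀ a s → a ℤ.+ s ℤ.- (a ℤ.- s) ≡ + 2 ℤ.* s
      difference = solve-∀
      n∣2s : + n ∣ + (2 ℕ.* s)
      n∣2s = subst (+ n ∣_)
        (begin
          linear j k (v ⊕ e) ℤ.- linear j k (v ⊖ e)
            ≡⟨ cong₂ ℤ._-_ (linear-⊕ v e) (linear-⊖ v e) ⟩
          linear j k v ℤ.+ linear j k e ℤ.- (linear j k v ℤ.- linear j k e)
            ≡⟨ difference (linear j k v) (linear j k e) ⟩
          + 2 ℤ.* linear j k e
            ≡⟨ cong (+ 2 ℤ.*_) e-step ⟩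
          + 2 ℤ.* + s
            ≡⟨ ℤ.pos-* 2 s ⟨
          + (2 ℕ.* s) ∎)
        (does-true (+ n ∣? _) (trans (sym (finEq-residue (linear j k (v ⊕ e)) (linear j k (v ⊖ e))))
          (trans (cong (λ a → finEq a (pos n (linear j k (v ⊖ e)))) eq) (finEq-refl (pos n (linear j k (v ⊖ e)))))))

  module Outer = Step j e₁ linear-e₁
  module Inner = Step k e₂ linear-e₂

  vEq-⟦⟧ : ∀ x y → eval o (same x y) ≡ vEq ⟦ x ⟧ ⟦ y ⟧
  vEq-⟦⟧ (inj₁ v) (inj₁ w) = sym (finEq-pos v w)
  vEq-⟦⟧ (inj₂ v) (inj₂ w) = sym (finEq-pos v w)
  vEq-⟦⟧ (inj₁ v) (inj₂ w) = refl
  vEq-⟦⟧ (inj₂ v) (inj₁ w) = refl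

  Iadj-⟦⟧ : ∀ x y → eval o (adjacent x y) ≡ Iadj n j k ⟦ x ⟧ ⟦ y ⟧
  Iadj-⟦⟧ (inj₁ v) (inj₁ w) = trans (∨-via-∧ (o (v ⊕ e₁ ⊖ w)) (o (w ⊕ e₁ ⊖ v))) (Outer.adjacent-pos v w)
  Iadj-⟦⟧ (inj₂ v) (inj₂ w) = trans (∨-via-∧ (o (v ⊕ e₂ ⊖ w)) (o (w ⊕ e₂ ⊖ v))) (Inner.adjacent-pos v w)
  Iadj-⟦⟧ (inj₁ v) (inj₂ w) = sym (finEq-pos v w)
  Iadj-⟦⟧ (inj₂ v) (inj₁ w) = sym (finEq-pos v w)

  notIn-⟦⟧ : ∀ x ys → eval o (avoids x ys) ≡ notIn ⟦ x ⟧ (map ⟦_⟧ ys)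
  notIn-⟦⟧ x []       = refl
  notIn-⟦⟧ x (y ∷ ys) = cong₂ (λ a b → not a ∧ b) (vEq-⟦⟧ x y) (notIn-⟦⟧ x ys)

  allDistinct-⟦⟧ : ∀ xs → eval o (distinct xs) ≡ allDistinct (map ⟦_⟧ xs)
  allDistinct-⟦⟧ []       = refl
  allDistinct-⟦⟧ (x ∷ xs) = cong₂ _∧_ (notIn-⟦⟧ x xs) (allDistinct-⟦⟧ xs)

  last-⟦⟧ : ∀ y zs → ⟦ last y zs ⟧ ≡ last ⟦ y ⟧ (map ⟦_⟧ zs)
  last-⟦⟧ y []       = refl
  last-⟦⟧ y (z ∷ zs) = last-⟦⟧ z zs

  module Counting (0<j : 0 < j) (2j<n : 2 ℕ.* j < n) (0<k : 0 < k) (2k<n : 2 ℕ.* k < n) where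

    -- A function that vanishes off the neighbours of a vertex has at most three nonzero terms, at
    -- distinct vertices, so none is counted twice.
    sum-neighbours : ∀ x (f : IVertex n → ℕ) → (∀ y → Iadj n j k ⟦ x ⟧ y ≡ false → f y ≡ 0) →
      sum (map f (allVertices n)) ≡ sum (map (f ∘ ⟦_⟧) (neighbours x))
    sum-neighbours (inj₁ v) f f≡0 = begin
      sum (map f (allVertices n))
        ≡⟨ sum-allVertices f ⟩
      sum (tabulate (f ∘ inj₁)) ℕ.+ sum (tabulate (f ∘ inj₂))
        ≡⟨ cong₂ ℕ._+_
             (sum-two (f ∘ inj₁) _ _ (Outer.⊕≢⊖ 0<j 2j<n v) λ b ≢⊕ ≢⊖ → f≡0 _ (Outer.off-neighbours v b ≢⊕ ≢⊖))
             (sum-one (f ∘ inj₂) _ λ b b≢ → f≡0 _ (finEq-false (b≢ ∘ sym))) ⟩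
      f⊕ ℕ.+ f⊖ ℕ.+ f⟂
        ≡⟨ cong (f⊕ ℕ.+ f⊖ ℕ.+_) (ℕ.+-identityʳ f⟂) ⟨
      f⊕ ℕ.+ f⊖ ℕ.+ (f⟂ ℕ.+ 0)
        ≡⟨ ℕ.+-assoc f⊕ f⊖ _ ⟩
      f⊕ ℕ.+ (f⊖ ℕ.+ (f⟂ ℕ.+ 0)) ∎
      where
      f⊕ = f ⟦ inj₁ (v ⊕ e₁) ⟧
      f⊖ = f ⟦ inj₁ (v ⊖ e₁) ⟧
      f⟂ = f ⟦ inj₂ v ⟧
    sum-neighbours (inj₂ v) f f≡0 = begin
      sum (map f (allVertices n))
        ≡⟨ sum-allVertices f ⟩
      sum (tabulate (f ∘ inj₁)) ℕ.+ sum (tabulate (f ∘ inj₂))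
        ≡⟨ cong₂ ℕ._+_
             (sum-one (f ∘ inj₁) _ λ b b≢ → f≡0 _ (finEq-false (b≢ ∘ sym)))
             (sum-two (f ∘ inj₂) _ _ (Inner.⊕≢⊖ 0<k 2k<n v) λ b ≢⊕ ≢⊖ → f≡0 _ (Inner.off-neighbours v b ≢⊕ ≢⊖)) ⟩
      f⟂ ℕ.+ (f⊕ ℕ.+ f⊖)
        ≡⟨ ℕ.+-comm f⟂ _ ⟩
      f⊕ ℕ.+ f⊖ ℕ.+ f⟂
        ≡⟨ cong (f⊕ ℕ.+ f⊖ ℕ.+_) (ℕ.+-identityʳ f⟂) ⟨
      f⊕ ℕ.+ f⊖ ℕ.+ (f⟂ ℕ.+ 0)
        ≡⟨ ℕ.+-assoc f⊕ f⊖ _ ⟩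
      f⊕ ℕ.+ (f⊖ ℕ.+ (f⟂ ℕ.+ 0)) ∎
      where
      f⊕ = f ⟦ inj₂ (v ⊕ e₂) ⟧
      f⊖ = f ⟦ inj₂ (v ⊖ e₂) ⟧
      f⟂ = f ⟦ inj₁ v ⟧

    neighbours-adjacent : ∀ x → All (λ y → Iadj n j k ⟦ x ⟧ ⟦ y ⟧ ≡ true) (neighbours x)
    neighbours-adjacent (inj₁ v) = Outer.adjacent-⊕ v ∷ Outer.adjacent-⊖ v ∷ finEq-refl (pos n (linear j k v)) ∷ []
    neighbours-adjacent (inj₂ v) = Inner.adjacent-⊕ v ∷ Inner.adjacent-⊖ v ∷ finEq-refl (pos n (linear j k v)) ∷ []

    -- Induction on the length, with `q` arbitrary because each step absorbs the chosen vertex into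
    -- it. For length 6 this replaces all tuples of vertices by 729 symbolic walks, whatever `n` is.
    count-paths : ∀ l x (q : List (IVertex n) → Bool) →
      count (λ ys → isPath n j k (⟦ x ⟧ ∷ ys) ∧ q ys) (lists (allVertices n) l) ≡ count (q ∘ map ⟦_⟧) (walks x l)
    count-paths zero    x q = trans (count-∷ (λ ys → isPath n j k (⟦ x ⟧ ∷ ys) ∧ q ys) [] []) (sym (count-∷ (q ∘ map ⟦_⟧) [] []))
    count-paths (suc l) x q = begin
      count (λ ys → isPath n j k (⟦ x ⟧ ∷ ys) ∧ q ys) (lists (allVertices n) (suc l))
        ≡⟨ count-extensions (λ ys → isPath n j k (⟦ x ⟧ ∷ ys) ∧ q ys) (λ _ → lists (allVertices n) l) (allVertices n) ⟩
      sum (map (λ y → count (λ ys → isPath n j k (⟦ x ⟧ ∷ y ∷ ys) ∧ q (y ∷ ys)) (lists (allVertices n) l)) (allVertices n))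
        -- An extension by a non-neighbour is no path, so its term is zero.
        ≡⟨ sum-neighbours x _ (λ y nonadjacent → count-none _
             (λ ys → cong (λ a → (a ∧ isPath n j k (y ∷ ys)) ∧ q (y ∷ ys)) nonadjacent) (lists (allVertices n) l)) ⟩
      sum (map (λ y → count (λ ys → isPath n j k (⟦ x ⟧ ∷ ⟦ y ⟧ ∷ ys) ∧ q (⟦ y ⟧ ∷ ys)) (lists (allVertices n) l)) (neighbours x))
        ≡⟨ cong sum (map-cong-local (All.map (λ {y} adj → trans
             (count-cong (λ ys → cong (λ a → (a ∧ isPath n j k (⟦ y ⟧ ∷ ys)) ∧ q (⟦ y ⟧ ∷ ys)) adj) (lists (allVertices n) l))
             (count-paths l y (q ∘ (⟦ y ⟧ ∷_)))) (neighbours-adjacent x))) ⟩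
      sum (map (λ y → count (q ∘ (⟦ y ⟧ ∷_) ∘ map ⟦_⟧) (walks y l)) (neighbours x))
        ≡⟨ count-extensions (q ∘ map ⟦_⟧) (λ y → walks y l) (neighbours x) ⟨
      count (q ∘ map ⟦_⟧) (walks x (suc l)) ∎

    -- The bridge to the symbolic side: the list of formulas is the same for all n, j and k, which
    -- enter only through the truth assignment `o`.
    eightCyclesThrough-⟦⟧ : ∀ x y → Iadj n j k ⟦ x ⟧ ⟦ y ⟧ ≡ true →
      eightCyclesThrough n j k ⟦ x ⟧ ⟦ y ⟧ ≡ count (eval o) (octagons x y)
    eightCyclesThrough-⟦⟧ x y adj = begin
      eightCyclesThrough n j k ⟦ x ⟧ ⟦ y ⟧
        -- The path condition moves to the front for `count-paths`, and the closing edge moves ahead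
        -- of distinctness to match `closes`.
        ≡⟨ count-cong (λ zs → trans
             (cong (λ a → allDistinct (⟦ x ⟧ ∷ ⟦ y ⟧ ∷ zs) ∧ (a ∧ isPath n j k (⟦ y ⟧ ∷ zs)) ∧ Iadj n j k (last ⟦ y ⟧ zs) ⟦ x ⟧) adj)
             (rotate (allDistinct (⟦ x ⟧ ∷ ⟦ y ⟧ ∷ zs)) (isPath n j k (⟦ y ⟧ ∷ zs)) (Iadj n j k (last ⟦ y ⟧ zs) ⟦ x ⟧))) (lists (allVertices n) 6) ⟩
      count (λ zs → isPath n j k (⟦ y ⟧ ∷ zs) ∧ closed zs) (lists (allVertices n) 6)
        ≡⟨ count-paths 6 y closed ⟩
      count (closed ∘ map ⟦_⟧) (walks y 6)
        ≡⟨ count-cong (λ zs → cong₂ _∧_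
             (trans (cong (λ z → Iadj n j k z ⟦ x ⟧) (sym (last-⟦⟧ y zs))) (sym (Iadj-⟦⟧ (last y zs) x)))
             (sym (allDistinct-⟦⟧ (x ∷ y ∷ zs)))) (walks y 6) ⟩
      count (eval o ∘ closes x y) (walks y 6)
        ≡⟨ count-map (eval o) (closes x y) (walks y 6) ⟨
      count (eval o) (octagons x y) ∎
      where
      closed : List (IVertex n) → Bool
      closed zs = Iadj n j k (last ⟦ y ⟧ zs) ⟦ x ⟧ ∧ allDistinct (⟦ x ⟧ ∷ ⟦ y ⟧ ∷ zs)
      rotate : ∀ a b c → a ∧ b ∧ c ≡ b ∧ c ∧ a
      rotate a b c = trans (Bool.∧-comm a (b ∧ c)) (Bool.∧-assoc b c a)

-- Soundness of simplification and of the comparison of counts.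

Sound : (Vec² → Bool) → Knowledge → Set
Sound o K = ∀ v {b} → K v ≡ just b → o v ≡ b

guard-eval : ∀ o b φ → eval o (guard b φ) ≡ b ∧ eval o φ
guard-eval o true  φ = refl
guard-eval o false φ = refl

and′-eval : ∀ o φ ψ → eval o (φ and′ ψ) ≡ eval o φ ∧ eval o ψ
and′-eval o (const b)   ψ         = guard-eval o b ψ
and′-eval o φ@(atom _)  (const b) = trans (guard-eval o b φ) (Bool.∧-comm b (eval o φ))
and′-eval o φ@(_ and _) (const b) = trans (guard-eval o b φ) (Bool.∧-comm b (eval o φ))
and′-eval o φ@(neg _)   (const b) = trans (guard-eval o b φ) (Bool.∧-comm b (eval o φ))
and′-eval o (atom _)    (atom _)  = refl
and′-eval o (atom _)    (_ and _) = refl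
and′-eval o (atom _)    (neg _)   = refl
and′-eval o (_ and _)   (atom _)  = refl
and′-eval o (_ and _)   (_ and _) = refl
and′-eval o (_ and _)   (neg _)   = refl
and′-eval o (neg _)     (atom _)  = refl
and′-eval o (neg _)     (_ and _) = refl
and′-eval o (neg _)     (neg _)   = refl

neg′-eval : ∀ o φ → eval o (neg′ φ) ≡ not (eval o φ)
neg′-eval o (atom _)  = refl
neg′-eval o (const _) = refl
neg′-eval o (_ and _) = refl
neg′-eval o (neg _)   = refl

simplify-eval : ∀ {o K} → Sound o K → ∀ φ → eval o (simplify K φ) ≡ eval o φ
simplify-eval         sound (const b) = refl
simplify-eval {o} {K} sound (φ and ψ) =
  trans (and′-eval o (simplify K φ) (simplify K ψ)) (cong₂ _∧_ (simplify-eval sound φ) (simplify-eval sound ψ))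
simplify-eval {o} {K} sound (neg φ) =
  trans (neg′-eval o (simplify K φ)) (cong not (simplify-eval sound φ))
simplify-eval {o} {K} sound (atom v) with K v in eq
... | just b  = sym (sound v eq)
... | nothing = refl

count-satisfiable : ∀ o φs → count (eval o) (filterᵇ satisfiable φs) ≡ count (eval o) φs
count-satisfiable o []                  = refl
count-satisfiable o (const false ∷ φs)  = count-satisfiable o φs
count-satisfiable o (const true ∷ φs)   = cong suc (count-satisfiable o φs)
count-satisfiable o (φ@(atom _) ∷ φs)   = count-∷-cong (eval o) φ (count-satisfiable o φs)
count-satisfiable o (φ@(_ and _) ∷ φs)  = count-∷-cong (eval o) φ (count-satisfiable o φs)
count-satisfiable o (φ@(neg _) ∷ φs)    = count-∷-cong (eval o) φ (count-satisfiable o φs)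

count-reduce : ∀ {o K} → Sound o K → ∀ φs → count (eval o) (reduce K φs) ≡ count (eval o) φs
count-reduce {o} {K} sound φs = begin
  count (eval o) (reduce K φs)            ≡⟨ count-satisfiable o (map (simplify K) φs) ⟩
  count (eval o) (map (simplify K) φs)    ≡⟨ count-map (eval o) (simplify K) φs ⟩
  count (eval o ∘ simplify K) φs          ≡⟨ count-cong (simplify-eval sound) φs ⟩
  count (eval o) φs                       ∎

count-valid : ∀ o φs → count valid φs ≤ count (eval o) φs
count-valid o []       = z≤n
count-valid o (φ ∷ φs) = subst₂ _≤_ (sym (count-∷ valid φ φs)) (sym (count-∷ (eval o) φ φs))
  (ℕ.+-mono-≤ (valid-eval φ) (count-valid o φs))
  where
  valid-eval : ∀ φ → (if valid φ then 1 else 0) ≤ (if eval o φ then 1 else 0)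
  valid-eval (atom _)      = z≤n
  valid-eval (const true)  = ℕ.≤-refl
  valid-eval (const false) = z≤n
  valid-eval (_ and _)     = z≤n
  valid-eval (neg _)       = z≤n

record Equal₃ (o : Vec² → Bool) (F : Triple) : Set where
  constructor equal₃
  field
    outer≡spoke : count (eval o) (proj₁ F) ≡ count (eval o) (proj₂ (proj₂ F))
    inner≡spoke : count (eval o) (proj₁ (proj₂ F)) ≡ count (eval o) (proj₂ (proj₂ F))

equal-reduce₃ : ∀ {o K} → Sound o K → ∀ F → Equal₃ o F → Equal₃ o (reduce₃ K F)
equal-reduce₃ sound (φs , ψs , χs) (equal₃ φ≡χ ψ≡χ) = equal₃
  (trans (count-reduce sound φs) (trans φ≡χ (sym (count-reduce sound χs))))
  (trans (count-reduce sound ψs) (trans ψ≡χ (sym (count-reduce sound χs))))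

separated-≢ : ∀ o φs ψs → T (separated φs ψs) → count (eval o) φs ≢ count (eval o) ψs
separated-≢ o φs ψs sep = ℕ.<⇒≢ (ℕ.≤-<-trans (length-filter (T? ∘ eval o) φs)
  (ℕ.<-≤-trans (ℕ.<ᵇ⇒< (length φs) _ sep) (count-valid o ψs)))

unbalanced-≢ : ∀ o F → T (unbalanced F) → ¬ Equal₃ o F
unbalanced-≢ o (φs , ψs , χs) unb (equal₃ φ≡χ ψ≡χ) with Equivalence.to Bool.T-∨ unb
... | inj₁ sep = separated-≢ o φs χs sep φ≡χ
... | inj₂ unb′ with Equivalence.to Bool.T-∨ unb′
...   | inj₁ sep = separated-≢ o ψs χs sep ψ≡χ
...   | inj₂ unb″ with Equivalence.to Bool.T-∨ unb″
...     | inj₁ sep = separated-≢ o χs φs sep (sym φ≡χ)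
...     | inj₂ sep = separated-≢ o χs ψs sep (sym ψ≡χ)

-- Hands each branch the evidence of the decision, which the nested conditionals of `knowledge`
-- reduce to a Boolean.
if-elim : ∀ {A R : Set} {x y z : Maybe Bool} (a? : Dec A) →
  (A → x ≡ z → R) → (¬ A → y ≡ z → R) → (if does a? then x else y) ≡ z → R
if-elim (yes a) then-case else-case = then-case a
if-elim (no ¬a) then-case else-case = else-case ¬a

-- The solutions of the congruence, and the contradiction for large `n`.

module Relations (m j k : ℕ) (coprime : gcd (gcd (suc m) j) k ≡ 1) where
  private n = suc m
  open Interpretation m j k

  Zero : Vec² → Set
  Zero v = + n ∣ linear j k v

  zero⇒o : ∀ v → Zero v → o v ≡ true
  zero⇒o v = dec-true (+ n ∣? linear j k v)

  o⇒zero : ∀ v → o v ≡ true → Zero v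
  o⇒zero v = does-true (+ n ∣? linear j k v)

  ¬zero⇒o : ∀ v → ¬ Zero v → o v ≡ false
  ¬zero⇒o v = dec-false (+ n ∣? linear j k v)

  o⇒¬zero : ∀ v → o v ≡ false → ¬ Zero v
  o⇒¬zero v = does-false (+ n ∣? linear j k v)

  zero-⊖ : ∀ v w → Zero v → Zero w → Zero (v ⊖ w)
  zero-⊖ v w zv zw = subst (+ n ∣_) (sym (linear-⊖ v w)) (∣m∣n⇒∣m-n zv zw)

  zero-⊕ : ∀ v w → Zero v → Zero w → Zero (v ⊕ w)
  zero-⊕ v w zv zw = subst (+ n ∣_) (sym (linear-⊕ v w)) (∣m∣n⇒∣m+n zv zw)

  zero-scale : ∀ t v → Zero v → Zero (scale t v)
  zero-scale t v@(a , b) zv = subst (+ n ∣_) (solve-scale t a b (+ j) (+ k)) (∣n⇒∣m*n t zv)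
    where
    solve-scale : ∀ t a b j k → t ℤ.* (a ℤ.* j ℤ.+ b ℤ.* k) ≡ (t ℤ.* a) ℤ.* j ℤ.+ (t ℤ.* b) ℤ.* k
    solve-scale = solve-∀

  zero-⊝ : ∀ v → Zero (⊝ v) → Zero v
  zero-⊝ v@(a , b) zv = subst (+ n ∣_) (solve-⊝ a b (+ j) (+ k)) (∣m⇒∣-m zv)
    where
    solve-⊝ : ∀ a b j k → ℤ.- ((ℤ.- a) ℤ.* j ℤ.+ (ℤ.- b) ℤ.* k) ≡ a ℤ.* j ℤ.+ b ℤ.* k
    solve-⊝ = solve-∀

  -- Cramer's rule gives n ∣ det · j and n ∣ det · k; coprimality removes j and k.
  ∣-det : ∀ c v → Zero c → Zero v → n ℕ.∣ ∣ det c v ∣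
  ∣-det c@(a , b) v@(p , q) zc zv = subst (n ℕ.∣_) D*1≡D
    (gcd-greatest (gcd-greatest (ℕ.n∣m*n D) (along j D*j)) (along k D*k))
    where
    D = ∣ det c v ∣
    eliminate-k : ∀ a b p q j k →
      q ℤ.* (a ℤ.* j ℤ.+ b ℤ.* k) ℤ.- b ℤ.* (p ℤ.* j ℤ.+ q ℤ.* k) ≡ (a ℤ.* q ℤ.- b ℤ.* p) ℤ.* j
    eliminate-k = solve-∀
    eliminate-j : ∀ a b p q j k →
      a ℤ.* (p ℤ.* j ℤ.+ q ℤ.* k) ℤ.- p ℤ.* (a ℤ.* j ℤ.+ b ℤ.* k) ≡ (a ℤ.* q ℤ.- b ℤ.* p) ℤ.* k
    eliminate-j = solve-∀
    D*j : + n ∣ det c v ℤ.* + j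
    D*j = subst (+ n ∣_) (eliminate-k a b p q (+ j) (+ k)) (∣m∣n⇒∣m-n (∣n⇒∣m*n q zc) (∣n⇒∣m*n b zv))
    D*k : + n ∣ det c v ℤ.* + k
    D*k = subst (+ n ∣_) (eliminate-j a b p q (+ j) (+ k)) (∣m∣n⇒∣m-n (∣n⇒∣m*n a zv) (∣n⇒∣m*n p zc))
    along : ∀ s → + n ∣ det c v ℤ.* + s → n ℕ.∣ D ℕ.* s
    along s d = subst (n ℕ.∣_) (ℤ.abs-* (det c v) (+ s)) (∣⇒∣ᵤ d)
    D*1≡D : gcd (gcd (D ℕ.* n) (D ℕ.* j)) (D ℕ.* k) ≡ D
    D*1≡D = begin
      gcd (gcd (D ℕ.* n) (D ℕ.* j)) (D ℕ.* k)   ≡⟨ cong (λ g → gcd g (D ℕ.* k)) (c*gcd[m,n]≡gcd[cm,cn] D n j) ⟨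
      gcd (D ℕ.* gcd n j) (D ℕ.* k)             ≡⟨ c*gcd[m,n]≡gcd[cm,cn] D (gcd n j) k ⟨
      D ℕ.* gcd (gcd n j) k                     ≡⟨ cong (D ℕ.*_) coprime ⟩
      D ℕ.* 1                                   ≡⟨ ℕ.*-identityʳ D ⟩
      D                                         ∎

  Refuted : List Vec² → Set
  Refuted = All (λ v → o v ≡ false)

  member-refuted : ∀ {B} v → Refuted B → Any (λ b → v ≡ b ⊎ v ≡ ⊝ b) B → ¬ Zero v
  member-refuted v (ob ∷ _)     (here {b} (inj₁ v≡b))  zv = o⇒¬zero b ob (subst Zero v≡b zv)
  member-refuted v (ob ∷ _)     (here {b} (inj₂ v≡⊝b)) zv = o⇒¬zero b ob (zero-⊝ b (subst Zero v≡⊝b zv))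
  member-refuted v (_ ∷ refuted) (there v∈B)           zv = member-refuted v refuted v∈B zv

  knowledge-sound : ∀ N B c → N ≤ n → Refuted B → o c ≡ true → Sound o (knowledge N B c)
  knowledge-sound N B c N≤n refuted oc v =
    if-elim (member? B v)
      (λ v∈B → refute (member-refuted v refuted v∈B))
      λ _ → if-elim (∣ det c v ∣ ℕ.≟ 0)
        (λ _ → if-elim (multiple? c v)
          (λ { v∈ℤc refl → zero⇒o v (multiple-zero v∈ℤc) })
          -- Here v is parallel to c without being a listed multiple. For c = (8,0), the vector
          -- (6,0) is excluded since (6,0) - (8,0) is the negative of (2,0).
          λ _ → if-elim (member? B (v ⊖ c))
            (λ ∈B → refute λ zv → member-refuted (v ⊖ c) refuted ∈B (zero-⊖ v c zv zc))
            λ _ → if-elim (member? B (v ⊕ c))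
              (λ ∈B → refute λ zv → member-refuted (v ⊕ c) refuted ∈B (zero-⊕ v c zv zc))
              λ _ ())
        λ D≢0 → if-elim (∣ det c v ∣ ℕ.<? N)
          -- Otherwise n, being at least N, would divide a positive number below N.
          (λ D<N → refute λ zv → ℕ.>⇒∤ {{ℕ.≢-nonZero D≢0}} (ℕ.<-≤-trans D<N N≤n) (∣-det c v zc zv))
          λ _ ()
    where
    zc : Zero c
    zc = o⇒zero c oc
    refute : ∀ {b} → ¬ Zero v → just false ≡ just b → o v ≡ b
    refute ¬zv refl = ¬zero⇒o v ¬zv
    multiple-zero : ∀ {ts} → Any (λ t → v ≡ scale t c) ts → Zero v
    multiple-zero (here {t} v≡tc) = subst Zero (sym v≡tc) (zero-scale t c zc)
    multiple-zero (there v∈ℤc)    = multiple-zero v∈ℤc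

  zero-𝟎 : o 𝟎 ≡ true
  zero-𝟎 = zero⇒o 𝟎 (divides 0ℤ refl)

  equal-base : ∀ F → Refuted nonzero → Equal₃ o F → Equal₃ o (reduce₃ base F)
  equal-base F refuted = equal-reduce₃ (knowledge-sound 0 nonzero 𝟎 z≤n refuted zero-𝟎) F

  knowledge-balanced : ∀ F B c → 41 ≤ n → Refuted B → o c ≡ true → Equal₃ o F →
    ¬ T (unbalanced (reduce₃ (knowledge 41 B c) F))
  knowledge-balanced F B c 41≤n refuted oc equal unb =
    unbalanced-≢ o (reduce₃ (knowledge 41 B c) F) unb
      (equal-reduce₃ (knowledge-sound 41 B c 41≤n refuted oc) F equal)

  -- Some entry of `cases` always applies: first decide `diag`, then look for a solution in
  -- `closing`. One solution is enough to start from, because any other vector whose determinant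
  -- with it is nonzero and below 41 is excluded.
  largeCheck-sound : ∀ F → T (largeCheck F) → 41 ≤ n → Refuted nonzero → ¬ Equal₃ o F
  largeCheck-sound F checked 41≤n refuted equal = by-diag (o diag) refl
    where
    all-unbalanced : All (λ Bc → T (unbalanced (reduce₃ (knowledge 41 (proj₁ Bc) (proj₂ Bc)) F))) cases
    all-unbalanced = all⁺ (λ Bc → unbalanced (reduce₃ (knowledge 41 (proj₁ Bc) (proj₂ Bc)) F)) cases checked
    impossible : ∀ {B c} → (B , c) ∈ cases → Refuted B → ¬ (o c ≡ true)
    impossible {B} {c} Bc∈cases refutedB oc =
      knowledge-balanced F B c 41≤n refutedB oc equal (All.lookup all-unbalanced Bc∈cases)
    by-closing : o diag ≡ false → Dec (Any (λ c → o c ≡ true) closing) → ⊥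
    by-closing o-diag (yes some) = let c , c∈closing , oc = find some in
      impossible (there (there (∈-map⁺ (diag ∷ nonzero ,_) c∈closing))) (o-diag ∷ refuted) oc
    -- Only the octagons u₀ u_j w_j w_{j+k} u_{j+k} u_k w_k w₀ and their rotations remain. Each has
    -- two outer, two inner and four spoke edges, so the three counts are 2, 2 and 4.
    by-closing o-diag (no none) = impossible (there (here refl))
      (o-diag ∷ ++⁺ (All.map Bool.¬-not (¬Any⇒All¬ closing none)) refuted) zero-𝟎
    by-diag : ∀ b → o diag ≡ b → ⊥
    by-diag true  o-diag = impossible (here refl) refuted o-diag
    by-diag false o-diag = by-closing o-diag (any? (λ c → o c Bool.≟ true) closing)

-- From regularity to similarity with an exceptional pair.

all-upTo : ∀ p N i → i < N → T (all p (upTo N)) → T (p i)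
all-upTo p N i i<N holds = All.lookup (all⁺ p (upTo N) holds) (∈-upTo⁺ i<N)

module Admissible (m j k : ℕ) (0<j : 0 < j) (2j<n : 2 ℕ.* j < suc m) (0<k : 0 < k) (2k<n : 2 ℕ.* k < suc m)
                  (coprime : gcd (gcd (suc m) j) k ≡ 1) where
  private n = suc m
  open Interpretation m j k
  open Relations m j k coprime
  open Counting 0<j 2j<n 0<k 2k<n

  small-refuted : ∀ v x → linear j k v ≡ + x → 0 < x → x < n → o v ≡ false
  small-refuted v x v≡x 0<x x<n = ¬zero⇒o v λ zv →
    ℕ.<⇒≢ 0<x (sym (ℤ.+-injective (∣-small (+ x) (subst (+ n ∣_) v≡x zv) x<n)))

  nonzero-refuted : Refuted nonzero
  nonzero-refuted =
    small-refuted (+ 1 , + 0) j linear-e₁ 0<j (half 2j<n) ∷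
    small-refuted (+ 2 , + 0) (2 ℕ.* j) (trans (ℤ.+-identityʳ _) (sym (ℤ.pos-* 2 j))) (ℕ.<-≤-trans 0<j (ℕ.m≤m+n j _)) 2j<n ∷
    small-refuted (+ 0 , + 1) k linear-e₂ 0<k (half 2k<n) ∷
    small-refuted (+ 0 , + 2) (2 ℕ.* k) (trans (ℤ.+-identityˡ _) (sym (ℤ.pos-* 2 k))) (ℕ.<-≤-trans 0<k (ℕ.m≤m+n k _)) 2k<n ∷
    small-refuted (+ 1 , + 1) (j ℕ.+ k) (cong₂ ℤ._+_ (ℤ.*-identityˡ (+ j)) (ℤ.*-identityˡ (+ k)))
      (ℕ.<-≤-trans 0<j (ℕ.m≤m+n j k)) j+k<n ∷ []
    where
    half : ∀ {s} → 2 ℕ.* s < n → s < n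
    half = ℕ.≤-<-trans (ℕ.m≤m+n _ _)
    j+k<n : j ℕ.+ k < n
    j+k<n = ℕ.*-cancelˡ-< 2 (j ℕ.+ k) n (subst₂ _<_ (sym (ℕ.*-distribˡ-+ 2 j k)) (cong (n ℕ.+_) (sym (ℕ.+-identityʳ n)))
      (ℕ.+-mono-< 2j<n 2k<n))

  regular⇒equal : ∀ {λ′} → OneCycleRegular8 n j k λ′ → Equal₃ o octagons₃
  regular⇒equal {λ′} regular = equal₃
    (trans (through (inj₁ 𝟎) (inj₁ e₁) outer) (sym spokes))
    (trans (through (inj₂ 𝟎) (inj₂ e₂) inner) (sym spokes))
    where
    through : ∀ x y → Iadj n j k ⟦ x ⟧ ⟦ y ⟧ ≡ true → count (eval o) (octagons x y) ≡ λ′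
    through x y adj = trans (sym (eightCyclesThrough-⟦⟧ x y adj)) (regular ⟦ x ⟧ ⟦ y ⟧ adj)
    outer : Iadj n j k ⟦ inj₁ 𝟎 ⟧ ⟦ inj₁ e₁ ⟧ ≡ true
    outer = Outer.adjacent-⊕ 𝟎
    inner : Iadj n j k ⟦ inj₂ 𝟎 ⟧ ⟦ inj₂ e₂ ⟧ ≡ true
    inner = Inner.adjacent-⊕ 𝟎
    spokes : count (eval o) (octagons (inj₁ 𝟎) (inj₂ 𝟎)) ≡ λ′
    spokes = through (inj₁ 𝟎) (inj₂ 𝟎) (finEq-refl (pos n (linear j k 𝟎)))

  smallCheck-sound : ∀ F → T (smallCheck F) → n ≤ 40 → Equal₃ o F → Any (Similar n j k) exceptionalPairs
  smallCheck-sound F checked n≤40 (equal₃ φ≡χ ψ≡χ) = does-true (exceptional? n j k)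
    (Equivalence.to Bool.T-≡ (modus-ponens (balanced F o)
      (modus-ponens (admissible n j k) settled-k admitted) is-balanced))
    where
    modus-ponens : ∀ a {b} → T (not a ∨ b) → T a → T b
    modus-ponens true b _ = b
    _&_ : ∀ {a b} → T a → T b → T (a ∧ b)
    Ta & Tb = Equivalence.from Bool.T-∧ (Ta , Tb)
    bound : ∀ s → 2 ℕ.* s < n → s < 21
    -- The strict bound is relaxed from 40 to 42 = 2 · 21, so that the factor 2 cancels.
    bound s 2s<n = ℕ.*-cancelˡ-< 2 s 21 (ℕ.<-≤-trans 2s<n (ℕ.≤-trans n≤40 (ℕ.m≤m+n 40 2)))
    settled-n : T (all (λ j → all (settled F n j) (upTo 21)) (upTo 21))
    settled-n = all-upTo (λ n → all (λ j → all (settled F n j) (upTo 21)) (upTo 21)) 41 n (s≤s n≤40) checked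
    settled-j : T (all (settled F n j) (upTo 21))
    settled-j = all-upTo (λ j → all (settled F n j) (upTo 21)) 21 j (bound j 2j<n) settled-n
    settled-k : T (settled F n j k)
    settled-k = all-upTo (settled F n j) 21 k (bound k 2k<n) settled-j
    admitted : T (admissible n j k)
    admitted = _&_ {0 <ᵇ j} (ℕ.<⇒<ᵇ 0<j) (_&_ {2 ℕ.* j <ᵇ n} (ℕ.<⇒<ᵇ 2j<n)
      (_&_ {0 <ᵇ k} (ℕ.<⇒<ᵇ 0<k) (_&_ {2 ℕ.* k <ᵇ n} (ℕ.<⇒<ᵇ 2k<n) (ℕ.≡⇒≡ᵇ (gcd (gcd n j) k) 1 coprime))))
    is-balanced : T (balanced F o)
    is-balanced = _&_ {count (eval o) (proj₁ F) ≡ᵇ count (eval o) (proj₂ (proj₂ F))}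
      (ℕ.≡⇒≡ᵇ _ _ φ≡χ) (ℕ.≡⇒≡ᵇ _ _ ψ≡χ)

  -- Stated for an arbitrary triple of lists, so the concrete octagons enter only through the two
  -- evaluated checks.
  similar-exceptional : ∀ F → smallCheck (reduce₃ base F) ≡ true → largeCheck (reduce₃ base F) ≡ true →
    Equal₃ o F → Any (Similar n j k) exceptionalPairs
  similar-exceptional F small large equal =
    [ (λ n≤40 → smallCheck-sound (reduce₃ base F) (Equivalence.from Bool.T-≡ small) n≤40 reduced)
    , (λ 40<n → contradiction reduced
        (largeCheck-sound (reduce₃ base F) (Equivalence.from Bool.T-≡ large) 40<n nonzero-refuted))
    ]′ (ℕ.≤-<-connex n 40)
    where
    reduced : Equal₃ o (reduce₃ base F)
    reduced = equal-base F nonzero-refuted equal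

-- Isomorphisms from units modulo `n` and from exchanging the sides.

module Multiplication (m : ℕ) where
  private n = suc m

  mul : ℕ → Fin n → Fin n
  mul a x = pos n (+ a ℤ.* + toℕ x)

  mul-residue : ∀ a x → Residue n (toℕ (mul a x)) (+ a ℤ.* + toℕ x)
  mul-residue a x = pos-residue (+ a ℤ.* + toℕ x)

  mul-inverse : ∀ {a b} → + n ∣ + a ℤ.* + b ℤ.- 1ℤ → ∀ x → mul a (mul b x) ≡ x
  mul-inverse {a} {b} unit x = finEq-true (trans
    (residue-≡ᵇ (mul-residue a (mul b x)) (toℕ-residue x))
    (dec-true (+ n ∣? _) (subst (+ n ∣_) (expand (+ a) (+ b) (+ toℕ (mul b x)) (+ toℕ x))
      (∣m∣n⇒∣m+n (∣n⇒∣m*n (+ a) (Residue.congruent (mul-residue b x))) (∣m⇒∣m*n (+ toℕ x) unit)))))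
    where
    expand : ∀ a b y x → a ℤ.* (y ℤ.- b ℤ.* x) ℤ.+ (a ℤ.* b ℤ.- 1ℤ) ℤ.* x ≡ a ℤ.* y ℤ.- x
    expand = solve-∀

  module _ {a b} (unit : + n ∣ + a ℤ.* + b ℤ.- 1ℤ) where

    unit-cancel : ∀ z → + n ∣ + a ℤ.* z → + n ∣ z
    unit-cancel z n∣az = subst (+ n ∣_) (cancel (+ a) (+ b) z) (∣m∣n⇒∣m-n (∣n⇒∣m*n (+ b) n∣az) (∣m⇒∣m*n z unit))
      where
      cancel : ∀ a b z → b ℤ.* (a ℤ.* z) ℤ.- (a ℤ.* b ℤ.- 1ℤ) ℤ.* z ≡ z
      cancel = solve-∀

    mul-finEq : ∀ x y → finEq (mul a x) (mul a y) ≡ finEq x y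
    mul-finEq x y = begin
      finEq (mul a x) (mul a y)
        ≡⟨ residue-≡ᵇ (mul-residue a x) (mul-residue a y) ⟩
      does (+ n ∣? + a ℤ.* + toℕ x ℤ.- + a ℤ.* + toℕ y)
        ≡⟨ cong (λ z → does (+ n ∣? z)) (factor (+ a) (+ toℕ x) (+ toℕ y)) ⟩
      does (+ n ∣? + a ℤ.* (+ toℕ x ℤ.- + toℕ y))
        ≡⟨ does-⇔ (mk⇔ (unit-cancel _) (∣n⇒∣m*n (+ a))) (+ n ∣? _) (+ n ∣? _) ⟩
      does (+ n ∣? + toℕ x ℤ.- + toℕ y)
        ≡⟨ residue-≡ᵇ (toℕ-residue x) (toℕ-residue y) ⟨
      finEq x y ∎
      where
      factor : ∀ a x y → a ℤ.* x ℤ.- a ℤ.* y ≡ a ℤ.* (x ℤ.- y)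
      factor = solve-∀

    -- The common part of `step-same` and `step-reverse`: the tested difference is congruent to a ·
    -- z, and the unit `a` cancels.
    step-test : ∀ {s} x y z → + n ∣ (+ a ℤ.* + toℕ x ℤ.+ + s ℤ.- + a ℤ.* + toℕ y) ℤ.- + a ℤ.* z →
      stepIs n s (mul a x) (mul a y) ≡ does (+ n ∣? z)
    step-test {s} x y z ≈az = trans
      (residue-≡ᵇ (step-residue s (mul-residue a x)) (mul-residue a y))
      (does-⇔ (mk⇔ to from) (+ n ∣? u) (+ n ∣? z))
      where
      u = + a ℤ.* + toℕ x ℤ.+ + s ℤ.- + a ℤ.* + toℕ y
      minus : ∀ u v → u ℤ.- (u ℤ.- v) ≡ v
      minus = solve-∀
      plus : ∀ u v → (u ℤ.- v) ℤ.+ v ≡ u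
      plus = solve-∀
      to : + n ∣ u → + n ∣ z
      to d = unit-cancel z (subst (+ n ∣_) (minus u (+ a ℤ.* z)) (∣m∣n⇒∣m-n d ≈az))
      from : + n ∣ z → + n ∣ u
      from d = subst (+ n ∣_) (plus u (+ a ℤ.* z)) (∣m∣n⇒∣m+n ≈az (∣n⇒∣m*n (+ a) d))

    step-same : ∀ {t s} → + n ∣ + a ℤ.* + t ℤ.- + s → ∀ x y → stepIs n s (mul a x) (mul a y) ≡ stepIs n t x y
    step-same {t} {s} at≈s x y = trans
      (step-test x y (+ toℕ x ℤ.+ + t ℤ.- + toℕ y)
        (subst (+ n ∣_) (factor (+ a) (+ t) (+ s) (+ toℕ x) (+ toℕ y)) (∣m⇒∣-m at≈s)))
      (sym (residue-≡ᵇ (step-residue t (toℕ-residue x)) (toℕ-residue y)))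
      where
      factor : ∀ a t s x y → ℤ.- (a ℤ.* t ℤ.- s) ≡ (a ℤ.* x ℤ.+ s ℤ.- a ℤ.* y) ℤ.- a ℤ.* (x ℤ.+ t ℤ.- y)
      factor = solve-∀

    -- Since a · t ≡ -s, multiplication by `a` reverses the direction of a step. The reversal
    -- disappears in adjacency, which allows both directions.
    step-reverse : ∀ {t s} → + n ∣ + a ℤ.* + t ℤ.+ + s → ∀ x y → stepIs n s (mul a x) (mul a y) ≡ stepIs n t y x
    step-reverse {t} {s} at≈-s x y = begin
      stepIs n s (mul a x) (mul a y)
        ≡⟨ step-test x y (+ toℕ x ℤ.- (+ toℕ y ℤ.+ + t))
             (subst (+ n ∣_) (factor (+ a) (+ t) (+ s) (+ toℕ x) (+ toℕ y)) at≈-s) ⟩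
      does (+ n ∣? + toℕ x ℤ.- (+ toℕ y ℤ.+ + t))
        ≡⟨ ∣?-swap n (+ toℕ x) (+ toℕ y ℤ.+ + t) ⟩
      does (+ n ∣? (+ toℕ y ℤ.+ + t) ℤ.- + toℕ x)
        ≡⟨ residue-≡ᵇ (step-residue t (toℕ-residue y)) (toℕ-residue x) ⟨
      stepIs n t y x ∎
      where
      factor : ∀ a t s x y → a ℤ.* t ℤ.+ s ≡ (a ℤ.* x ℤ.+ s ℤ.- a ℤ.* y) ℤ.- a ℤ.* (x ℤ.- (y ℤ.+ t))
      factor = solve-∀

    mul-adjacent : ∀ {t s} → PlusMinus n a t s → ∀ x y →
      (stepIs n s (mul a x) (mul a y) ∨ stepIs n s (mul a y) (mul a x)) ≡ (stepIs n t x y ∨ stepIs n t y x)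
    mul-adjacent (inj₁ at≈s)  x y = cong₂ _∨_ (step-same at≈s x y) (step-same at≈s y x)
    mul-adjacent (inj₂ at≈-s) x y =
      trans (cong₂ _∨_ (step-reverse at≈-s x y) (step-reverse at≈-s y x)) (Bool.∨-comm (stepIs n _ y x) _)

    mul↔ : Fin n ↔ Fin n
    mul↔ = mk↔ₛ′ (mul a) (mul b) (mul-inverse {a} {b} unit) (mul-inverse {b} {a} (subst (+ n ∣_) (cong (ℤ._- 1ℤ) (ℤ.*-comm (+ a) (+ b))) unit))

    iso-parallel : ∀ {j k j′ k′} → PlusMinus n a j j′ → PlusMinus n a k k′ → IsoI n j k n j′ k′
    iso-parallel {j} {k} {j′} {k′} aj≈j′ ak≈k′ = (mul↔ ⊎-↔ mul↔) , preserves
      where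
      preserves : ∀ x y → Iadj n j′ k′ (Sum.map (mul a) (mul a) x) (Sum.map (mul a) (mul a) y) ≡ Iadj n j k x y
      preserves (inj₁ x) (inj₁ y) = mul-adjacent aj≈j′ x y
      preserves (inj₂ x) (inj₂ y) = mul-adjacent ak≈k′ x y
      preserves (inj₁ x) (inj₂ y) = mul-finEq x y
      preserves (inj₂ x) (inj₁ y) = mul-finEq x y

swap-sides : ∀ n j k → IsoI n j k n k j
swap-sides n j k = Sum.swap-↔ , preserves
  where
  preserves : ∀ x y → Iadj n k j (Sum.swap x) (Sum.swap y) ≡ Iadj n j k x y
  preserves (inj₁ x) (inj₁ y) = refl
  preserves (inj₂ x) (inj₂ y) = refl
  preserves (inj₁ x) (inj₂ y) = refl
  preserves (inj₂ x) (inj₁ y) = refl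

iso-trans : ∀ {n j k n′ j′ k′ n″ j″ k″} → IsoI n j k n′ j′ k′ → IsoI n′ j′ k′ n″ j″ k″ → IsoI n j k n″ j″ k″
iso-trans (f , f-adj) (g , g-adj) = (g ↔-∘ f) , λ x y → trans (g-adj _ _) (f-adj x y)

similar⇒iso : ∀ m j k {p} → Similar (suc m) j k p → IsoI (suc m) j k (proj₁ p) 1 (proj₂ p)
similar⇒iso m j k (refl , some-a) with satisfied some-a
... | a , relations , some-b with satisfied some-b | relations
...   | b , unit | inj₁ (aj≈1 , ak≈k′) = Multiplication.iso-parallel m {a} {b} unit aj≈1 ak≈k′
...   | b , unit | inj₂ (aj≈k′ , ak≈1) =
  -- Here `a` carries k to ±1, so the sides are exchanged first to make k the outer step.
  iso-trans (swap-sides (suc m) j k) (Multiplication.iso-parallel m {a} {b} unit ak≈1 aj≈k′)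

some-similar⇒iso : ∀ m j k {ps} → Any (Similar (suc m) j k) ps →
  Σ (ℕ × ℕ) λ p → (p ∈ ps) × IsoI (suc m) j k (proj₁ p) 1 (proj₂ p)
some-similar⇒iso m j k some = let p , p∈ps , similar = find some in p , p∈ps , similar⇒iso m j k similar

-- Evaluation of the two checks, and the conclusion.

smallCheck-octagons : smallCheck (reduce₃ base octagons₃) ≡ true
smallCheck-octagons = refl

-- By evaluation in 24 cases: `diag`, no closing vector, and each of the 22 closing vectors.
largeCheck-octagons : largeCheck (reduce₃ base octagons₃) ≡ true
largeCheck-octagons = refl

theorem1 : (n j k : ℕ) → 3 ≤ n → 1 ≤ j → 2 * j < n → 1 ≤ k → 2 * k < n →
    gcd (gcd n j) k ≡ 1 → (λ′ : ℕ) → OneCycleRegular8 n j k λ′ →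
    Σ (ℕ × ℕ) λ p → (p ∈ exceptionalPairs) × IsoI n j k (Data.Product.proj₁ p) 1 (Data.Product.proj₂ p)
theorem1 (suc m) j k _ 0<j 2j<n 0<k 2k<n coprime λ′ regular = some-similar⇒iso m j k
  (similar-exceptional octagons₃ smallCheck-octagons largeCheck-octagons (regular⇒equal {λ′} regular))
  where open Admissible m j k 0<j 2j<n 0<k 2k<n coprime
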